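{- Let $n$ and $k$ be positive integers satisfying $n\geq 8(2k+2)^2$. Then $$2k+1 \le tw(G_{n,k}) \le pw(G_{n,k}) \le 2k+2.$$
   Context: For positive integers $k<n/2$, the generalized Petersen graph $G_{n,k}$ is the simple graph with vertex set $\{v_1,\dots,v_n,u_1,\dots,u_n\}$ and edge set $\{v_iu_i\}\cup\{v_iv_{i+1}\}\cup\{u_iu_{i+k}\}$, $i=1,\dots,n$, with subscripts read modulo $n$. $tw$ and $pw$ denote treewidth and pathwidth. -}

module Defs where

open import Data.Empty using (⊥)
open import Data.Fin.Base using (Fin; zero; toℕ; splitAt)
open import Data.Fin.Permutation using (Permutation′; _⟨$⟩ʳ_; id)
open import Data.Fin.Properties
  using (nonZeroIndex; toℕ-fromℕ<; injective⇒≤) renaming (_≟_ to _≟ᶠ_)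
open import Data.Fin.Subset using (Subset; _∈_; ∣_∣; ⊤)
open import Data.Fin.Subset.Properties using (∈⊤)
open import Data.List.Base using (map; allFin)
open import Data.List.Extrema.Nat using (max)
open import Data.Nat.Base
  using (ℕ; suc; NonZero; >-nonZero; _+_; _*_; _∸_; _≤_; _<_; s≤s)
open import Data.Nat.Divisibility using (_∣_; divides; >⇒∤)
open import Data.Nat.DivMod using (_mod_; _%_; _/_; m%n<n; m≡m%n+[m/n]*n)
open import Data.Nat.Induction using (<-rec)
open import Data.Nat.Properties
  using (+-cancelˡ-≡; ≤-<-trans; ≤-trans; ≮⇒≥; ≤-antisym; m≤m+n)
open import Data.Product.Base using (Σ; ∃; _×_; _,_; proj₁)
open import Data.Sum.Base using (_⊎_; inj₁; inj₂)
open import Function.Bundles using (_⇔_; mk⇔)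
open import Function.Definitions using (Injective)
open import Level using (0ℓ)
open import Relation.Binary.Construct.Closure.ReflexiveTransitive using (Star; ε)
open import Relation.Binary.Construct.Closure.Symmetric
  using (SymClosure; fwd; bwd; symmetric)
open import Relation.Binary.Core using (Rel)
open import Relation.Binary.Definitions using (Symmetric; Irreflexive; Decidable)
open import Relation.Binary.PropositionalEquality
  using (_≡_; refl; sym; trans; cong)
open import Relation.Nullary using (¬_; yes; no)
open import Relation.Nullary.Decidable using (map′; _⊎-dec_)

------------------------------------------------------------------------
-- Finite simple graphs

record Graph (N : ℕ) : Set₁ where
  infix 4 _~_ _~?_
  field
    _~_      : Rel (Fin N) 0ℓ
    ~-sym    : Symmetric _~_
    ~-irrefl : Irreflexive _≡_ _~_
    _~?_     : Decidable _~_

-- Addition modulo n; the residues are 0, …, n - 1.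

infixl 6 _⊕_

_⊕_ : ∀ {n} → Fin n → ℕ → Fin n
_⊕_ {n} i k = _mod_ (toℕ i + k) n {{nonZeroIndex i}}

Connected : ∀ {N} → Graph N → Set
Connected G = ∀ x y → Star _~_ x y
  where open Graph G

record Cycle {N} (G : Graph N) : Set where
  open Graph G
  field
    len       : ℕ
    3≤len     : 3 ≤ len
    vertex    : Fin len → Fin N
    injective : Injective _≡_ _≡_ vertex
    adjacent  : ∀ i → vertex i ~ vertex (i ⊕ 1)

record IsTree {N} (G : Graph N) : Set where
  field
    nonEmpty  : NonZero N
    connected : Connected G
    acyclic   : ¬ Cycle G

-- The vertices can be listed so that the edges are exactly the pairs of
-- consecutive vertices.

IsPath : ∀ {N} → Graph N → Set
IsPath {N} G = Σ (Permutation′ N) λ σ → ∀ i j →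
  (σ ⟨$⟩ʳ i) ~ (σ ⟨$⟩ʳ j) ⇔ (toℕ j ≡ suc (toℕ i) ⊎ toℕ i ≡ suc (toℕ j))
  where open Graph G

------------------------------------------------------------------------
-- Treewidth and pathwidth

record TreeDecomposition {N} (G : Graph N) : Set₁ where
  open Graph G
  field
    size   : ℕ
    tree   : Graph size
    isTree : IsTree tree
    bag    : Fin size → Subset N

  -- Adjacency in the subgraph of the tree induced by the nodes whose bags
  -- contain x.
  TreeAdj : Fin N → Rel (Fin size) 0ℓ
  TreeAdj x s t = Graph._~_ tree s t × x ∈ bag s × x ∈ bag t

  field
    coversVertices : ∀ x → ∃ λ t → x ∈ bag t
    coversEdges    : ∀ {x y} → x ~ y → ∃ λ t → x ∈ bag t × y ∈ bag t
    subtrees       : ∀ {x s t} → x ∈ bag s → x ∈ bag t → Star (TreeAdj x) s t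

  -- Truncated subtraction matters only for the graph without vertices, whose
  -- width is then 0 instead of the customary -1.
  width : ℕ
  width = max 0 (map (λ t → ∣ bag t ∣) (allFin size)) ∸ 1

PathDecomposition : ∀ {N} → Graph N → Set₁
PathDecomposition G =
  Σ (TreeDecomposition G) λ D → IsPath (TreeDecomposition.tree D)

Least : ∀ {ℓ} → (ℕ → Set ℓ) → ℕ → Set ℓ
Least P w = P w × (∀ {v} → P v → w ≤ v)

-- The minimum width is expressed as a relation, not as a function: computing it
-- would need a bound on the size of the trees. The relation is
-- functional, and a value cannot fail to exist; see the end of this module.

IsTreewidth : ∀ {N} → Graph N → ℕ → Set₁
IsTreewidth G = Least λ w →
  Σ (TreeDecomposition G) λ D → TreeDecomposition.width D ≡ w

IsPathwidth : ∀ {N} → Graph N → ℕ → Set₁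
IsPathwidth G = Least λ w →
  Σ (PathDecomposition G) λ D → TreeDecomposition.width (proj₁ D) ≡ w

------------------------------------------------------------------------
-- Generalized Petersen graphs

pattern v i = inj₁ i
pattern u i = inj₂ i

data Arc {n} (k : ℕ) : Rel (Fin n ⊎ Fin n) 0ℓ where
  spoke : ∀ {i j} → j ≡ i     → Arc k (v i) (u j)
  outer : ∀ {i j} → j ≡ i ⊕ 1 → Arc k (v i) (v j)
  inner : ∀ {i j} → j ≡ i ⊕ k → Arc k (u i) (u j)

arc? : ∀ {n} k → Decidable (Arc {n} k)
arc? k (v i) (v j) = map′ outer (λ { (outer p) → p }) (j ≟ᶠ i ⊕ 1)
arc? k (v i) (u j) = map′ spoke (λ { (spoke p) → p }) (j ≟ᶠ i)
arc? k (u i) (v j) = no λ ()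
arc? k (u i) (u j) = map′ inner (λ { (inner p) → p }) (j ≟ᶠ i ⊕ k)

⊕-fixed : ∀ {n} (i : Fin n) {k} → i ≡ i ⊕ k → n ∣ k
⊕-fixed {n} i {k} i≡i⊕k = divides ((toℕ i + k) / n) (+-cancelˡ-≡ (toℕ i) _ _
  (trans (m≡m%n+[m/n]*n (toℕ i + k) n)
         (cong (_+ (toℕ i + k) / n * n) (sym i≡[i+k]%n))))
  where
  instance n≢0 = nonZeroIndex i

  i≡[i+k]%n : toℕ i ≡ (toℕ i + k) % n
  i≡[i+k]%n = trans (cong toℕ i≡i⊕k) (toℕ-fromℕ< (m%n<n (toℕ i + k) n))

arc-irrefl : ∀ {n k} → 1 ≤ k → k < n → ∀ {x} → ¬ Arc {n} k x x
arc-irrefl 1≤k k<n (outer {i} p) = >⇒∤ (≤-<-trans 1≤k k<n) (⊕-fixed i p)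
arc-irrefl 1≤k k<n (inner {i} p) =
  >⇒∤ {{>-nonZero 1≤k}} k<n (⊕-fixed i p)

-- Fin (n + n) is split into v₀, …, vₙ₋₁ followed by u₀, …, uₙ₋₁; the condition
-- k < n/2 reads 2 * k < n.

petersen : ∀ n k → 1 ≤ k → 2 * k < n → Graph (n + n)
petersen n k 1≤k 2k<n = record
  { _~_      = λ x y → SymClosure (Arc k) (splitAt n x) (splitAt n y)
  ; ~-sym    = symmetric (Arc k)
  ; ~-irrefl = λ { refl (fwd a) → arc-irrefl 1≤k k<n a
                 ; refl (bwd a) → arc-irrefl 1≤k k<n a }
  ; _~?_     = λ x y → map′
      (λ { (inj₁ a) → fwd a ; (inj₂ a) → bwd a })
      (λ { (fwd a) → inj₁ a ; (bwd a) → inj₂ a })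
      (arc? k (splitAt n x) (splitAt n y) ⊎-dec arc? k (splitAt n y) (splitAt n x))
  }
  where
  k<n : k < n
  k<n = ≤-<-trans (m≤m+n k _) 2k<n

------------------------------------------------------------------------
-- Treewidth and pathwidth are well defined: unique, and not non-existent

least-unique : ∀ {ℓ} {P : ℕ → Set ℓ} {w w′} → Least P w → Least P w′ → w ≡ w′
least-unique (p , min) (p′ , min′) = ≤-antisym (min p′) (min′ p)

least-exists : ∀ {ℓ} {P : ℕ → Set ℓ} {w} → P w → ¬ ¬ ∃ (Least P)
least-exists {P = P} {w} p ∄ = <-rec (λ m → ¬ P m)
  (λ m rec q → ∄ (m , q , λ {l} r → ≮⇒≥ λ l<m → rec l<m r)) w p

trivialDecomposition : ∀ {N} (G : Graph N) → PathDecomposition G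
trivialDecomposition G = record
  { size           = 1
  ; tree           = point
  ; isTree         = record
    { nonEmpty  = _
    ; connected = λ { zero zero → ε }
    ; acyclic   = λ c → 3≰1 (≤-trans (Cycle.3≤len c) (injective⇒≤ (Cycle.injective c)))
    }
  ; bag            = λ _ → ⊤
  ; coversVertices = λ _ → zero , ∈⊤
  ; coversEdges    = λ _ → zero , ∈⊤ , ∈⊤
  ; subtrees       = λ { {_} {zero} {zero} _ _ → ε }
  } , id , λ { zero zero → mk⇔ (λ ()) (λ { (inj₁ ()) ; (inj₂ ()) }) }
  where
  point : Graph 1
  point = record
    { _~_ = λ _ _ → ⊥ ; ~-sym = λ () ; ~-irrefl = λ _ () ; _~?_ = λ _ _ → no λ () }

  3≰1 : ¬ 3 ≤ 1
  3≰1 (s≤s ())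

treewidth-exists : ∀ {N} (G : Graph N) → ¬ ¬ ∃ (IsTreewidth G)
treewidth-exists G = least-exists (proj₁ (trivialDecomposition G) , refl)

pathwidth-exists : ∀ {N} (G : Graph N) → ¬ ¬ ∃ (IsPathwidth G)
pathwidth-exists G = least-exists (trivialDecomposition G , refl)

{-# OPTIONS --safe #-}

-- Lower bound. Let X have at most 2k + 1 vertices. Of 4k + 3 disjoint blocks of k consecutive
-- columns, some avoid X; they all lie in one component of G - X, because any two blocks are
-- joined by 2k + 2 tracks, k + 1 on either side of the circle, which are disjoint outside the
-- blocks. Two such sets X and Y are avoided by a common block, so the components chosen for
-- them meet. If all bags had at most 2k + 1 vertices, then moving from every node of the tree
-- towards the component chosen for its bag would never turn back, which is impossible in a
-- finite tree.
--
-- Upper bound. Keep k + 1 vertices that cut the circle open in every bag, and sweep the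
-- remaining strip with a front of k + 1 vertices, exchanging one vertex at a time.

module Submission where

open import Defs
open import Data.Fin.Base using (Fin; zero; suc; toℕ; fromℕ<; splitAt; _↑ˡ_; _↑ʳ_)
open import Data.Fin.Permutation using (id)
open import Data.Fin.Properties
  using (any?; toℕ<n; toℕ-injective; toℕ-fromℕ<; nonZeroIndex; pigeonhole;
         splitAt-↑ˡ; splitAt-↑ʳ; splitAt⁻¹-↑ˡ; splitAt⁻¹-↑ʳ)
  renaming (_≟_ to _≟ᶠ_)
open import Data.Fin.Subset
  using (Subset; _∈_; _∉_; ∣_∣; inside; outside; _∪_; ⋃; ⁅_⁆; _-_)
open import Data.Fin.Subset.Properties
  using (_∈?_; ∣⊥∣≡0; ∣⁅x⁆∣≡1; x∈⁅x⁆; p⊆p∪q; q⊆p∪q; p⊆q⇒∣p∣≤∣q∣; x∈p∧x≢y⇒x∈p-y;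
         x∈p⇒∣p-x∣<∣p∣)
open import Data.List.Base using (List; []; _∷_; _++_; length; lookup; map; upTo; allFin)
open import Data.List.Extrema.Nat using (max; max≤v⁺; xs≤max)
import Data.List.Membership.DecPropositional as DecMembership
open import Data.List.Membership.Propositional using () renaming (_∈_ to _∈ˡ_)
open import Data.List.Membership.Propositional.Properties
  using (∈-map⁺; ∈-upTo⁺; ∈-lookup; ∈-++⁺ˡ; ∈-++⁺ʳ; ∈-allFin)
open import Data.List.Properties using (length-map; length-upTo; length-++)
open import Data.List.Relation.Unary.All as All using ()
open import Data.List.Relation.Unary.All.Properties using (map⁺; map⁻; ¬Any⇒All¬)
open import Data.List.Relation.Unary.AllPairs using ([]; _∷_)
open import Data.List.Relation.Unary.Any using (here; there)
open import Data.List.Relation.Unary.Linked as Linked using (Linked; [-]; _∷_)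
open import Data.List.Relation.Unary.Unique.Propositional using (Unique)
open import Data.Nat.Base
  using (ℕ; zero; suc; NonZero; >-nonZero; >-nonZero⁻¹; _+_; _*_; _∸_; _^_; _⊔_; _≤_; _<_;
         z≤n; s≤s; s≤s⁻¹)
open import Data.Nat.Divisibility using (>⇒∤)
open import Data.Nat.DivMod
open import Data.Nat.Properties
open import Data.Nat.Tactic.RingSolver using (solve-∀)
open import Data.Product.Base using (∃; _×_; _,_; proj₁; proj₂) renaming (swap to swap×)
open import Data.Sum.Base using (_⊎_; inj₁; inj₂; [_,_]′; swap)
open import Data.Vec.Base using ([]; _∷_; tabulate)
open import Data.Vec.Properties using (lookup⇒[]=; []=⇒lookup; lookup∘tabulate)
open import Function.Base using (_∘_)
open import Function.Bundles using (mk⇔)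
open import Level using (0ℓ)
open import Relation.Binary.Construct.Closure.ReflexiveTransitive as Star
  using (Star; ε; _◅_; _◅◅_)
open import Relation.Binary.Construct.Closure.Symmetric using (fwd; bwd)
open import Relation.Binary.Core using (Rel)
open import Relation.Binary.Definitions using (Symmetric)
open import Relation.Binary.PropositionalEquality
open import Relation.Nullary using (¬_; Dec; yes; no; contradiction)
open import Relation.Nullary.Decidable using (_×-dec_; _⊎-dec_; does; dec-true)

-- Cardinalities of subsets

∣p∪q∣≤∣p∣+∣q∣ : ∀ {n} (p q : Subset n) → ∣ p ∪ q ∣ ≤ ∣ p ∣ + ∣ q ∣
∣p∪q∣≤∣p∣+∣q∣ []            []            = z≤n
∣p∪q∣≤∣p∣+∣q∣ (outside ∷ p) (outside ∷ q) = ∣p∪q∣≤∣p∣+∣q∣ p q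
∣p∪q∣≤∣p∣+∣q∣ (outside ∷ p) (inside ∷ q)  =
  ≤-trans (s≤s (∣p∪q∣≤∣p∣+∣q∣ p q)) (≤-reflexive (sym (+-suc _ _)))
∣p∪q∣≤∣p∣+∣q∣ (inside ∷ p)  (outside ∷ q) = s≤s (∣p∪q∣≤∣p∣+∣q∣ p q)
∣p∪q∣≤∣p∣+∣q∣ (inside ∷ p)  (inside ∷ q)  =
  s≤s (≤-trans (∣p∪q∣≤∣p∣+∣q∣ p q) (+-monoʳ-≤ ∣ p ∣ (n≤1+n _)))

-- The list may repeat elements or contain extra ones, so a bag can be bounded by any explicit list
-- that covers it.
∣p∣≤length : ∀ {n} {p : Subset n} xs → (∀ {x} → x ∈ p → x ∈ˡ xs) → ∣ p ∣ ≤ length xs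
∣p∣≤length {n} xs p⊆xs = ≤-trans (p⊆q⇒∣p∣≤∣q∣ (∈-⋃ xs ∘ p⊆xs)) (∣⋃∣≤ xs)
  where
  ∈-⋃ : ∀ xs {x} → x ∈ˡ xs → x ∈ ⋃ (map ⁅_⁆ xs)
  ∈-⋃ (x ∷ xs) (here refl)  = p⊆p∪q _ (x∈⁅x⁆ x)
  ∈-⋃ (y ∷ xs) (there x∈xs) = q⊆p∪q _ _ (∈-⋃ xs x∈xs)

  ∣⋃∣≤ : ∀ xs → ∣ ⋃ (map ⁅_⁆ xs) ∣ ≤ length xs
  ∣⋃∣≤ []       = ≤-reflexive (∣⊥∣≡0 n)
  ∣⋃∣≤ (x ∷ xs) = ≤-trans (∣p∪q∣≤∣p∣+∣q∣ ⁅ x ⁆ _)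
    (+-mono-≤ (≤-reflexive (∣⁅x⁆∣≡1 x)) (∣⋃∣≤ xs))

-- Pigeonhole by induction on `m`: if no element of `p` takes the top value, that value is missed.
-- Otherwise one such element is removed; the value then found is smaller, so the removed element
-- does not take it either.
missedValue : ∀ {n} (f : Fin n → ℕ) (p : Subset n) {m} → ∣ p ∣ < m →
              ∃ λ t → t < m × (∀ {x} → x ∈ p → f x ≢ t)
missedValue f p {suc m} ∣p∣<1+m with any? (λ x → x ∈? p ×-dec f x ≟ m)
... | no ∄ = m , ≤-refl , λ x∈p fx≡m → ∄ (_ , x∈p , fx≡m)
... | yes (x , x∈p , fx≡m)
  with t , t<m , ≢t ← missedValue f (p - x) (<-≤-trans (x∈p⇒∣p-x∣<∣p∣ x∈p) (s≤s⁻¹ ∣p∣<1+m))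
  = t , m<n⇒m<1+n t<m , λ {y} y∈p fy≡t → ≢t
      (x∈p∧x≢y⇒x∈p-y y∈p λ { refl → <⇒≢ t<m (trans (sym fy≡t) fx≡m) }) fy≡t

-- Addition modulo n

toℕ-⊕ : ∀ {n} .{{_ : NonZero n}} (i : Fin n) k → toℕ (i ⊕ k) ≡ (toℕ i + k) % n
toℕ-⊕ i k = toℕ-fromℕ< _

toℕ-mod : ∀ m n .{{_ : NonZero n}} → toℕ (m mod n) ≡ m % n
toℕ-mod m n = toℕ-fromℕ< _

[m%n+o]%n≡[m+o]%n : ∀ m n o .{{_ : NonZero n}} → (m % n + o) % n ≡ (m + o) % n
[m%n+o]%n≡[m+o]%n m n o = trans (%-distribˡ-+ (m % n) o n)
  (trans (cong (λ a → (a + o % n) % n) (m%n%n≡m%n m n)) (sym (%-distribˡ-+ m o n)))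

⊕-mod : ∀ m n k .{{_ : NonZero n}} → (m mod n) ⊕ k ≡ (m + k) mod n
⊕-mod m n k = toℕ-injective (begin
  toℕ ((m mod n) ⊕ k)     ≡⟨ toℕ-⊕ (m mod n) k ⟩
  (toℕ (m mod n) + k) % n ≡⟨ cong (λ a → (a + k) % n) (toℕ-mod m n) ⟩
  (m % n + k) % n         ≡⟨ [m%n+o]%n≡[m+o]%n m n k ⟩
  (m + k) % n             ≡⟨ toℕ-mod (m + k) n ⟨
  toℕ ((m + k) mod n)     ∎)
  where open ≡-Reasoning

⊕-assoc : ∀ {n} (i : Fin n) a b → i ⊕ a ⊕ b ≡ i ⊕ (a + b)
⊕-assoc {n} i a b = trans (⊕-mod (toℕ i + a) n b)
  (cong (λ m → _mod_ m n) (+-assoc (toℕ i) a b))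
  where instance _ = nonZeroIndex i

-- Walks, paths and cycles

Deleting : ∀ {N} → Graph N → (Fin N → Set) → Rel (Fin N) 0ℓ
Deleting G P x y = x ~ y × ¬ P x × ¬ P y
  where open Graph G

Deleting-sym : ∀ {N} (G : Graph N) P → Symmetric (Deleting G P)
Deleting-sym G P (x~y , ¬Px , ¬Py) = Graph.~-sym G x~y , ¬Py , ¬Px

DeletingEdge : ∀ {N} → Graph N → Fin N → Fin N → Rel (Fin N) 0ℓ
DeletingEdge G a b x y = x ~ y × ¬ (x ≡ a × y ≡ b) × ¬ (x ≡ b × y ≡ a)
  where open Graph G

lastFrom : ∀ {A : Set} → A → List A → A
lastFrom x []       = x
lastFrom x (y ∷ ys) = lastFrom y ys

lookup-last : ∀ {A : Set} (x : A) xs i → toℕ i ≡ length xs → lookup (x ∷ xs) i ≡ lastFrom x xs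
lookup-last x []       zero    eq = refl
lookup-last x (y ∷ xs) (suc i) eq = lookup-last y xs i (suc-injective eq)

lookup-injective : ∀ {A : Set} {xs : List A} → Unique xs →
                   ∀ {i j} → lookup xs i ≡ lookup xs j → i ≡ j
lookup-injective (x∉xs ∷ uniq) {zero}  {zero}  eq = refl
lookup-injective (x∉xs ∷ uniq) {zero}  {suc j} eq = contradiction eq (All.lookup x∉xs (∈-lookup j))
lookup-injective (x∉xs ∷ uniq) {suc i} {zero}  eq =
  contradiction (sym eq) (All.lookup x∉xs (∈-lookup i))
lookup-injective (x∉xs ∷ uniq) {suc i} {suc j} eq = cong suc (lookup-injective uniq eq)

lookup-linked : ∀ {A : Set} {R : Rel A 0ℓ} {xs : List A} → Linked R xs →
                ∀ i j → toℕ j ≡ suc (toℕ i) → R (lookup xs i) (lookup xs j)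
lookup-linked [-]        zero    (suc ()) eq
lookup-linked (r ∷ link) zero    (suc zero) eq = r
lookup-linked (r ∷ link) (suc i) (suc j) eq = lookup-linked link i j (suc-injective eq)

record SimplePath {N} (R : Rel (Fin N) 0ℓ) (x y : Fin N) : Set where
  field
    rest    : List (Fin N)
    linked  : Linked R (x ∷ rest)
    unique  : Unique (x ∷ rest)
    ends-at : lastFrom x rest ≡ y

-- Loops are erased from the back of the walk: when the new first vertex already occurs on the path
-- built so far, only the part from that occurrence on is kept.
simplePath : ∀ {N} {R : Rel (Fin N) 0ℓ} {x y} → Star R x y → SimplePath R x y
simplePath ε = record { rest = [] ; linked = [-] ; unique = All.[] ∷ [] ; ends-at = refl }
simplePath {N} {R} {x} (r ◅ rs) = extend r (simplePath rs)
  where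
  open DecMembership {A = Fin N} _≟ᶠ_ using () renaming (_∈?_ to _∈ˡ?_)

  suffix : ∀ {z w xs y} → w ∈ˡ z ∷ xs → Linked R (z ∷ xs) → Unique (z ∷ xs) → lastFrom z xs ≡ y →
           SimplePath R w y
  suffix (here refl) link uniq end =
    record { rest = _ ; linked = link ; unique = uniq ; ends-at = end }
  suffix {xs = _ ∷ _} (there w∈) (_ ∷ link) (_ ∷ uniq) end = suffix w∈ link uniq end

  extend : ∀ {w z y} → R w z → SimplePath R z y → SimplePath R w y
  extend {w} {z} r path with w ∈ˡ? z ∷ rest
    where open SimplePath path
  ... | yes w∈ = suffix w∈ linked unique ends-at
    where open SimplePath path
  ... | no  w∉ = record
    { rest = z ∷ rest ; linked = r ∷ linked ; unique = ¬Any⇒All¬ _ w∉ ∷ unique ; ends-at = ends-at }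
    where open SimplePath path

module _ {N} (G : Graph N) where
  open Graph G

  closedPath⇒cycle : ∀ x xs → Linked _~_ (x ∷ xs) → Unique (x ∷ xs) → lastFrom x xs ~ x →
                     2 ≤ length xs → Cycle G
  closedPath⇒cycle x xs link uniq last~x 2≤len = record
    { len       = suc (length xs)
    ; 3≤len     = s≤s 2≤len
    ; vertex    = lookup (x ∷ xs)
    ; injective = lookup-injective uniq
    ; adjacent  = adjacent
    }
    where
    adjacent : ∀ i → lookup (x ∷ xs) i ~ lookup (x ∷ xs) (i ⊕ 1)
    -- Only at the last index does adding 1 wrap around to `zero`; there the closing edge is used.
    adjacent i with toℕ i ≟ length xs
    ... | yes i≡last = subst₂ _~_ (sym (lookup-last x xs i i≡last))
                         (cong (lookup (x ∷ xs)) (sym i⊕1≡0)) last~x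
      where
      i⊕1≡0 : i ⊕ 1 ≡ zero
      i⊕1≡0 = toℕ-injective (trans (toℕ-⊕ i 1) (trans
        (%-congˡ {o = suc (length xs)} (trans (+-comm (toℕ i) 1) (cong suc i≡last)))
        (n%n≡0 (suc (length xs)))))
    ... | no i≢last = lookup-linked link i (i ⊕ 1) (trans (toℕ-⊕ i 1) (trans
        (m<n⇒m%n≡m (subst (_< suc (length xs)) (+-comm 1 (toℕ i))
          (s≤s (≤∧≢⇒< (s≤s⁻¹ (toℕ<n i)) i≢last))))
        (+-comm (toℕ i) 1)))

  -- The detour, made simple, is closed by the edge from `a` to `b`. It has at least three vertices:
  -- its ends differ because they are adjacent, and the single step from `b` to `a` is deleted.
  detour⇒cycle : ∀ {a b} → a ~ b → Star (DeletingEdge G a b) b a → Cycle G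
  detour⇒cycle {a} {b} a~b detour = go rest linked unique ends-at
    where
    open SimplePath (simplePath detour)

    go : ∀ xs → Linked (DeletingEdge G a b) (b ∷ xs) → Unique (b ∷ xs) → lastFrom b xs ≡ a → Cycle G
    go []           link                  uniq refl = contradiction a~b (~-irrefl refl)
    go (_ ∷ [])     ((_ , _ , ¬ba) ∷ [-]) uniq refl = contradiction (refl , refl) ¬ba
    go (x ∷ y ∷ xs) link                  uniq end  = closedPath⇒cycle b (x ∷ y ∷ xs)
      (Linked.map proj₁ link) uniq (subst (_~ b) (sym end) a~b) (s≤s (s≤s z≤n))

  -- Iterating `f` revisits some vertex `x`. The walk from `f x`, stopped on its first arrival at
  -- `x`, never leaves `x`, and it could enter `x` from `f x` only by turning back. So it avoids the
  -- edge between them and closes to a cycle.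
  acyclic⇒backtracks : ¬ Cycle G → NonZero N → (f : Fin N → Fin N) → (∀ x → x ~ f x) →
                       ¬ (∀ x → f (f x) ≢ x)
  acyclic⇒backtracks acyclic N≢0 f x~fx ffx≢x = acyclic (periodic (pigeonhole ≤-refl (orbit ∘ toℕ)))
    where
    orbit : ℕ → Fin N
    orbit zero    = fromℕ< {0} (>-nonZero⁻¹ N {{N≢0}})
    orbit (suc m) = f (orbit m)

    detour : ∀ x m j → orbit (m + j) ≡ x → Star (DeletingEdge G x (f x)) (orbit j) x
    detour x zero    j eq = subst (Star _ _) eq ε
    detour x (suc m) j eq with orbit j ≟ᶠ x
    ... | yes refl = ε
    ... | no  ≢x   =
      (x~fx _ , (λ (eq₁ , _) → ≢x eq₁) , λ (eq₁ , eq₂) → ffx≢x x (trans (cong f (sym eq₁)) eq₂))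
      ◅ detour x m (suc j) (trans (cong orbit (+-suc m j)) eq)

    periodic : (∃ λ (i : Fin (suc N)) → ∃ λ (j : Fin (suc N)) →
                toℕ i < toℕ j × orbit (toℕ i) ≡ orbit (toℕ j)) → Cycle G
    periodic (i , j , i<j , eq) = detour⇒cycle (x~fx (orbit (toℕ i)))
      (detour (orbit (toℕ i)) (toℕ j ∸ suc (toℕ i)) (suc (toℕ i))
        (trans (cong orbit (m∸n+n≡m i<j)) (sym eq)))

-- h s names a component of G minus the bag of s, which occupies a single component of the tree
-- minus s. Stepping from every node towards that component must backtrack somewhere, along an
-- edge s t say; then the components named by h s and h t lie on opposite sides of this edge.
module _ {N} {G : Graph N} (D : TreeDecomposition G) where
  open TreeDecomposition D
  open IsTree isTree
  open Graph G
  private module T = Graph tree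

  noHaven : (h : Fin size → Fin N) → (∀ s → h s ∉ bag s) →
            ¬ (∀ s t → ∃ λ z → Star (Deleting G (_∈ bag s)) (h s) z ×
                               Star (Deleting G (_∈ bag t)) (h t) z)
  noHaven h h∉bag touch = acyclic⇒backtracks tree acyclic nonEmpty next next-adjacent λ s nns≡s →
    acyclic (detour⇒cycle tree (next-adjacent s) (detour s nns≡s))
    where
    -- The nodes of each vertex on the walk form a connected set avoiding `s`, and consecutive
    -- vertices share a node, so these sets join up.
    occupied : ∀ {s x y p q} → x ∉ bag s → Star (Deleting G (_∈ bag s)) x y →
               x ∈ bag p → y ∈ bag q → Star (Deleting tree (_≡ s)) p q
    occupied x∉s ε x∈p x∈q = Star.map
      (λ (a~b , x∈a , x∈b) → a~b , (λ { refl → x∉s x∈a }) , (λ { refl → x∉s x∈b }))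
      (subtrees x∈p x∈q)
    occupied x∉s ((x~w , _ , w∉s) ◅ walk) x∈p y∈q with t , x∈t , w∈t ← coversEdges x~w =
      occupied x∉s ε x∈p x∈t ◅◅ occupied w∉s walk w∈t y∈q

    -- Either the walk never meets `s`, or the part after its last visit to `s` begins at a
    -- neighbour of `s`. The start `a` is arbitrary for the induction.
    exit : ∀ s {a y} → y ≢ s → Star T._~_ a y →
           (a ≢ s × Star (Deleting tree (_≡ s)) a y) ⊎
           (∃ λ t → s T.~ t × Star (Deleting tree (_≡ s)) t y)
    exit s y≢s ε = inj₁ (y≢s , ε)
    exit s {a} y≢s (a~b ◅ walk) with exit s y≢s walk | a ≟ᶠ s
    ... | inj₂ found         | _        = inj₂ found
    ... | inj₁ (b≢s , walk′) | yes refl = inj₂ (_ , a~b , walk′)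
    ... | inj₁ (b≢s , walk′) | no  a≢s  = inj₁ (a≢s , (a~b , a≢s , b≢s) ◅ walk′)

    step : ∀ s → ∃ λ t → s T.~ t ×
           Star (Deleting tree (_≡ s)) t (proj₁ (coversVertices (h s)))
    step s with r , h∈r ← coversVertices (h s)
           with exit s (λ { refl → h∉bag s h∈r }) (connected s r)
    ... | inj₁ (s≢s , _) = contradiction refl s≢s
    ... | inj₂ found     = found

    next : Fin size → Fin size
    next s = proj₁ (step s)

    next-adjacent : ∀ s → s T.~ next s
    next-adjacent s = proj₁ (proj₂ (step s))

    next-reaches : ∀ s {z r} → Star (Deleting G (_∈ bag s)) (h s) z → z ∈ bag r →
                   Star (Deleting tree (_≡ s)) (next s) r
    next-reaches s walk z∈r = proj₂ (proj₂ (step s)) ◅◅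
      occupied (h∉bag s) walk (proj₂ (coversVertices (h s))) z∈r

    -- Both components contain `z`, whose node `r` is reached from `next s` while avoiding `s`, and
    -- from `s` while avoiding `next s`. Neither half can use the edge between these two nodes.
    detour : ∀ s → next (next s) ≡ s → Star (DeletingEdge tree s (next s)) (next s) s
    detour s nns≡s with z , walk , walk′ ← touch s (next s)
                   with r , z∈r ← coversVertices z =
      Star.map (λ (x~y , x≢s , y≢s) → x~y , (λ (eq , _) → x≢s eq) , (λ (_ , eq) → y≢s eq))
        (next-reaches s walk z∈r)
      ◅◅ Star.map (λ (x~y , x≢t , y≢t) → x~y , (λ (_ , eq) → y≢t eq) , (λ (eq , _) → x≢t eq))
        (Star.reverse (Deleting-sym tree (_≡ next s))
          (subst (λ t → Star (Deleting tree (_≡ next s)) t r) nns≡s (next-reaches (next s) walk′ z∈r)))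

-- Interval models

⟦_⟧ : ∀ {n} {P : Fin n → Set} → (∀ x → Dec (P x)) → Subset n
⟦ P? ⟧ = tabulate (λ x → does (P? x))

∈⟦⟧⁺ : ∀ {n} {P : Fin n → Set} (P? : ∀ x → Dec (P x)) {x} → P x → x ∈ ⟦ P? ⟧
∈⟦⟧⁺ P? {x} Px = lookup⇒[]= x _ (trans (lookup∘tabulate _ x) (dec-true (P? x) Px))

∈⟦⟧⁻ : ∀ {n} {P : Fin n → Set} (P? : ∀ x → Dec (P x)) {x} → x ∈ ⟦ P? ⟧ → P x
∈⟦⟧⁻ P? {x} x∈ with P? x | trans (sym (lookup∘tabulate (λ x → does (P? x)) x)) ([]=⇒lookup x∈)
... | yes Px | _ = Px
... | no  _  | ()

PathAdj : ∀ {m} → Rel (Fin m) 0ℓ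
PathAdj s t = toℕ t ≡ suc (toℕ s) ⊎ toℕ s ≡ suc (toℕ t)

pathGraph : ∀ m → Graph m
pathGraph m = record
  { _~_      = PathAdj
  ; ~-sym    = swap
  ; ~-irrefl = λ { refl (inj₁ eq) → 1+n≢n (sym eq) ; refl (inj₂ eq) → 1+n≢n (sym eq) }
  ; _~?_     = λ s t → (toℕ t ≟ suc (toℕ s)) ⊎-dec (toℕ s ≟ suc (toℕ t))
  }

pathGraph-isPath : ∀ m → IsPath (pathGraph m)
pathGraph-isPath m = id , λ i j → mk⇔ (λ adj → adj) (λ adj → adj)

-- Steps are demanded only between positions from `lo` to `hi`, so that the same walk serves the
-- whole path and the interval of nodes whose bags contain a given vertex.
walkUp : ∀ {m} {R : Rel (Fin m) 0ℓ} {lo hi} →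
         (∀ {s t} → toℕ t ≡ suc (toℕ s) → lo ≤ toℕ s → toℕ t ≤ hi → R s t) →
         ∀ d {s t} → d + toℕ s ≡ toℕ t → lo ≤ toℕ s → toℕ t ≤ hi → Star R s t
walkUp {R = R} step zero    {s} eq lo≤s t≤hi = subst (Star R s) (toℕ-injective eq) ε
walkUp {lo = lo} step (suc d) {s} {t} eq lo≤s t≤hi =
  step s′≡ lo≤s (≤-trans (subst (_≤ toℕ t) (sym s′≡) 1+s≤t) t≤hi)
  ◅ walkUp step d (trans (cong (d +_) s′≡) (trans (+-suc d (toℕ s)) eq))
      (≤-trans lo≤s (subst (toℕ s ≤_) (sym s′≡) (n≤1+n (toℕ s)))) t≤hi
  where
  1+s≤t : suc (toℕ s) ≤ toℕ t
  1+s≤t = subst (suc (toℕ s) ≤_) eq (s≤s (m≤n+m (toℕ s) d))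

  s′≡ : toℕ (fromℕ< (≤-<-trans 1+s≤t (toℕ<n t))) ≡ suc (toℕ s)
  s′≡ = toℕ-fromℕ< _

walkBetween : ∀ {m} {R : Rel (Fin m) 0ℓ} {lo hi} → Symmetric R →
              (∀ {s t} → toℕ t ≡ suc (toℕ s) → lo ≤ toℕ s → toℕ t ≤ hi → R s t) →
              ∀ {s t} → lo ≤ toℕ s → toℕ s ≤ hi → lo ≤ toℕ t → toℕ t ≤ hi → Star R s t
walkBetween R-sym step {s} {t} lo≤s s≤hi lo≤t t≤hi with ≤-total (toℕ s) (toℕ t)
... | inj₁ s≤t = walkUp step (toℕ t ∸ toℕ s) (m∸n+n≡m s≤t) lo≤s t≤hi
... | inj₂ t≤s = Star.reverse R-sym (walkUp step (toℕ s ∸ toℕ t) (m∸n+n≡m t≤s) lo≤t s≤hi)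

-- A cycle in a path never turns back, so the positions along it are strictly monotonic for ever.
pathGraph-acyclic : ∀ m → ¬ Cycle (pathGraph m)
pathGraph-acyclic m cycle with Cycle.adjacent cycle (fromℕ< (Cycle.3≤len cycle))
... | start = [ unbounded ∘ ascending , belowZero ∘ descending ]′ start
  where
  open Cycle cycle

  index : ℕ → Fin len
  index zero    = fromℕ< 3≤len
  index (suc j) = index j ⊕ 1

  position : ℕ → ℕ
  position j = toℕ (vertex (index j))

  -- Returning after two steps would, by injectivity, make the length of the cycle divide 2, but it
  -- is at least 3.
  noReturn : ∀ j → position (2 + j) ≢ position j
  noReturn j eq = >⇒∤ 3≤len (⊕-fixed (index j)
    (trans (sym (injective (toℕ-injective eq))) (⊕-assoc (index j) 1 1)))

  ascending : position 1 ≡ suc (position 0) → ∀ j → position (suc j) ≡ suc (position j)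
  ascending eq zero    = eq
  ascending eq (suc j) with adjacent (index (suc j))
  ... | inj₁ up   = up
  ... | inj₂ down = contradiction (suc-injective (trans (sym down) (ascending eq j))) (noReturn j)

  descending : position 0 ≡ suc (position 1) → ∀ j → position j ≡ suc (position (suc j))
  descending eq zero    = eq
  descending eq (suc j) with adjacent (index (suc j))
  ... | inj₁ up   = contradiction (trans up (sym (descending eq j))) (noReturn j)
  ... | inj₂ down = down

  unbounded : ¬ (∀ j → position (suc j) ≡ suc (position j))
  unbounded up = <⇒≱ (toℕ<n (vertex (index m))) (j≤position m)
    where
    j≤position : ∀ j → j ≤ position j
    j≤position zero    = z≤n
    j≤position (suc j) = subst (suc j ≤_) (sym (up j)) (s≤s (j≤position j))

  belowZero : ¬ (∀ j → position j ≡ suc (position (suc j)))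
  belowZero down = 1+n≰n (subst (suc (position 0) ≤_) (sum (suc (position 0))) (m≤m+n _ _))
    where
    sum : ∀ j → j + position j ≡ position 0
    sum zero    = refl
    sum (suc j) = trans (sym (+-suc j _)) (trans (cong (j +_) (sym (down j))) (sum j))

Overlap : ∀ {N} → (l r : Fin N → ℕ) → Rel (Fin N) 0ℓ
Overlap l r x y = l x ≤ r y × l y ≤ r x

module _ {N} (G : Graph N) (m : ℕ) (l r : Fin N → ℕ)
         (l≤r : ∀ x → l x ≤ r x) (l≤m : ∀ x → l x ≤ m)
         (overlaps : ∀ {x y} → Graph._~_ G x y → Overlap l r x y) where

  intervalBag : ℕ → Subset N
  intervalBag t = ⟦ (λ x → l x ≤? t ×-dec t ≤? r x) ⟧

  ∈-intervalBag⁺ : ∀ {t x} → l x ≤ t → t ≤ r x → x ∈ intervalBag t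
  ∈-intervalBag⁺ {t} l≤t t≤r = ∈⟦⟧⁺ (λ x → l x ≤? t ×-dec t ≤? r x) (l≤t , t≤r)

  ∈-intervalBag⁻ : ∀ {t x} → x ∈ intervalBag t → l x ≤ t × t ≤ r x
  ∈-intervalBag⁻ {t} = ∈⟦⟧⁻ (λ x → l x ≤? t ×-dec t ≤? r x)

  -- Vertex `x` is present during the interval from `l x` to `r x`. Two overlapping intervals share
  -- the larger of their left ends, which is the node chosen to cover an edge.
  intervalDecomposition : PathDecomposition G
  intervalDecomposition = record
    { size           = suc m
    ; tree           = pathGraph (suc m)
    ; isTree         = record
      { nonEmpty  = _
      ; connected = λ s t → walkBetween {lo = 0} {hi = m} swap (λ eq _ _ → inj₁ eq)
                      z≤n (s≤s⁻¹ (toℕ<n s)) z≤n (s≤s⁻¹ (toℕ<n t))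
      ; acyclic   = pathGraph-acyclic (suc m)
      }
    ; bag            = intervalBag ∘ toℕ
    ; coversVertices = λ x → node x x , inNode (m≤m⊔n _ _) (l≤r x) (l≤r x)
    ; coversEdges    = λ {x} {y} x~y → let lx≤ry , ly≤rx = overlaps x~y in
        node x y , inNode (m≤m⊔n _ _) (l≤r x) ly≤rx , inNode (m≤n⊔m _ _) lx≤ry (l≤r y)
    ; subtrees       = λ {x} x∈s x∈t →
        let lx≤s , s≤rx = ∈-intervalBag⁻ x∈s
            lx≤t , t≤rx = ∈-intervalBag⁻ x∈t
        in walkBetween (λ (adj , x∈s , x∈t) → swap adj , x∈t , x∈s)
             (λ {s} {t} eq lx≤s t≤rx → inj₁ eq ,
               ∈-intervalBag⁺ lx≤s (≤-trans (n≤1+n _) (subst (_≤ r x) eq t≤rx)) ,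
               ∈-intervalBag⁺ (≤-trans lx≤s (subst (toℕ s ≤_) (sym eq) (n≤1+n _))) t≤rx)
             lx≤s s≤rx lx≤t t≤rx
    } , pathGraph-isPath (suc m)
    where
    node : Fin N → Fin N → Fin (suc m)
    node x y = fromℕ< (s≤s (⊔-lub (l≤m x) (l≤m y)))

    inNode : ∀ {x y z} → l z ≤ l x ⊔ l y → l x ≤ r z → l y ≤ r z → z ∈ intervalBag (toℕ (node x y))
    inNode {z = z} lz≤ lx≤rz ly≤rz = subst (λ t → z ∈ intervalBag t) (sym (toℕ-fromℕ< _))
      (∈-intervalBag⁺ lz≤ (⊔-lub lx≤rz ly≤rz))

-- Width and the sizes of bags

module _ {N} {G : Graph N} (D : TreeDecomposition G) where
  open TreeDecomposition D

  private
    largest : ℕ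
    largest = max 0 (map (λ t → ∣ bag t ∣) (allFin size))

  width≤ : ∀ {w} → (∀ t → ∣ bag t ∣ ≤ w + 1) → width ≤ w
  width≤ {w} small = m≤n+o⇒m∸n≤o largest 1 (subst (largest ≤_) (+-comm w 1)
    (max≤v⁺ z≤n (map⁺ (All.universal small (allFin size)))))

  bag≤ : ∀ {w} → width ≤ w → ∀ t → ∣ bag t ∣ ≤ w + 1
  bag≤ {w} width≤w t = begin
    ∣ bag t ∣   ≤⟨ All.lookup (map⁻ (xs≤max 0 (map (λ t → ∣ bag t ∣) (allFin size)))) (∈-allFin t) ⟩
    largest     ≤⟨ m≤n+m∸n largest 1 ⟩
    1 + width   ≤⟨ s≤s width≤w ⟩
    1 + w       ≡⟨ +-comm 1 w ⟩
    w + 1       ∎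
    where open ≤-Reasoning

-- Generalized Petersen graphs

module Petersen (n k : ℕ) (1≤k : 1 ≤ k) (2k<n : 2 * k < n) where
  private
    instance
      k≢0 : NonZero k
      k≢0 = >-nonZero 1≤k

      n≢0 : NonZero n
      n≢0 = >-nonZero (≤-<-trans z≤n 2k<n)

  G : Graph (n + n)
  G = petersen n k 1≤k 2k<n

  open Graph G

  -- Columns are addressed by arbitrary natural numbers read modulo `n`, so that walks can pass the
  -- end of the numbering without a case distinction.
  V U : ℕ → Fin (n + n)
  V p = (p mod n) ↑ˡ n
  U p = n ↑ʳ (p mod n)

  V~U : ∀ p → V p ~ U p
  V~U p rewrite splitAt-↑ˡ n (p mod n) n | splitAt-↑ʳ n n (p mod n) = fwd (spoke refl)

  V~V : ∀ p → V p ~ V (p + 1)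
  V~V p rewrite splitAt-↑ˡ n (p mod n) n | splitAt-↑ˡ n ((p + 1) mod n) n =
    fwd (outer (sym (⊕-mod p n 1)))

  U~U : ∀ p → U p ~ U (p + k)
  U~U p rewrite splitAt-↑ʳ n n (p mod n) | splitAt-↑ʳ n n ((p + k) mod n) =
    fwd (inner (sym (⊕-mod p n k)))

  [p+n]mod-n : ∀ p → (p + n) mod n ≡ p mod n
  [p+n]mod-n p = toℕ-injective (trans (toℕ-mod (p + n) n)
    (trans ([m+n]%n≡m%n p n) (sym (toℕ-mod p n))))

  toℕ-[p]mod-n : ∀ {p} → p < n → toℕ (p mod n) ≡ p
  toℕ-[p]mod-n {p} p<n = trans (toℕ-mod p n) (m<n⇒m%n≡m p<n)

  -- The representative of the residue c in the window a, …, a + n - 1.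
  unwrap : ℕ → ℕ → ℕ
  unwrap a c with c <? a
  ... | yes _ = c + n
  ... | no  _ = c

  unwrap-< : ∀ {a c} → c < a → unwrap a c ≡ c + n
  unwrap-< {a} {c} c<a with c <? a
  ... | yes _   = refl
  ... | no  c≮a = contradiction c<a c≮a

  unwrap-≥ : ∀ {a c} → a ≤ c → unwrap a c ≡ c
  unwrap-≥ {a} {c} a≤c with c <? a
  ... | yes c<a = contradiction a≤c (<⇒≱ c<a)
  ... | no  _   = refl

  -- If `p < n`, the residue is `p` itself. Otherwise it is `p - n`, which lies below `a` and
  -- therefore gets `n` back.
  unwrap-mod : ∀ {a p} → a ≤ n → a ≤ p → p < a + n → unwrap a (toℕ (p mod n)) ≡ p
  unwrap-mod {a} {p} a≤n a≤p p<a+n with p <? n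
  ... | yes p<n = trans (cong (unwrap a) (toℕ-[p]mod-n p<n)) (unwrap-≥ a≤p)
  ... | no  p≮n = begin
    unwrap a (toℕ (p mod n))           ≡⟨ cong (λ q → unwrap a (toℕ (q mod n))) p≡ ⟨
    unwrap a (toℕ ((p ∸ n + n) mod n)) ≡⟨ cong (unwrap a ∘ toℕ) ([p+n]mod-n (p ∸ n)) ⟩
    unwrap a (toℕ ((p ∸ n) mod n))     ≡⟨ cong (unwrap a) (toℕ-[p]mod-n (<-≤-trans p∸n<a a≤n)) ⟩
    unwrap a (p ∸ n)                   ≡⟨ unwrap-< p∸n<a ⟩
    p ∸ n + n                          ≡⟨ p≡ ⟩
    p                                  ∎
    where
    open ≡-Reasoning
    p≡ : p ∸ n + n ≡ p
    p≡ = m∸n+n≡m (≮⇒≥ p≮n)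

    p∸n<a : p ∸ n < a
    p∸n<a = +-cancelʳ-< n _ _ (subst (_< a + n) (sym p≡) p<a+n)

  column : Fin (n + n) → ℕ
  column x with splitAt n x
  ... | v i = toℕ i
  ... | u i = toℕ i

  column-V : ∀ p → column (V p) ≡ toℕ (p mod n)
  column-V p rewrite splitAt-↑ˡ n (p mod n) n = refl

  column-U : ∀ p → column (U p) ≡ toℕ (p mod n)
  column-U p rewrite splitAt-↑ʳ n n (p mod n) = refl

  -- The window a, …, a + n - 1 is cut into a, …, b - 1 and b, …, a + n - 1. Each part is crossed
  -- by k + 1 tracks: the outer path, of number 0, and for every r < k the inner vertices of
  -- columns congruent to r, of number 1 + r. The tracks of the second part are shifted by k + 1.
  shift : ℕ → ℕ → ℕ
  shift b p with p <? b
  ... | yes _ = 0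
  ... | no  _ = suc k

  localTrack : Fin n ⊎ Fin n → ℕ → ℕ
  localTrack (v _) p = 0
  localTrack (u _) p = suc (p % k)

  track : ℕ → ℕ → Fin (n + n) → ℕ
  track a b x = shift b p + localTrack (splitAt n x) p
    where
    p : ℕ
    p = unwrap a (column x)

  shift-< : ∀ {b p} → p < b → shift b p ≡ 0
  shift-< {b} {p} p<b with p <? b
  ... | yes _   = refl
  ... | no  p≮b = contradiction p<b p≮b

  shift-≥ : ∀ {b p} → b ≤ p → shift b p ≡ suc k
  shift-≥ {b} {p} b≤p with p <? b
  ... | yes p<b = contradiction b≤p (<⇒≱ p<b)
  ... | no  _   = refl

  track-V : ∀ {a b p} → a ≤ n → a ≤ p → p < a + n → track a b (V p) ≡ shift b p + 0
  track-V {a} {b} {p} a≤n a≤p p<a+n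
    rewrite column-V p | splitAt-↑ˡ n (p mod n) n | unwrap-mod a≤n a≤p p<a+n = refl

  track-U : ∀ {a b p} → a ≤ n → a ≤ p → p < a + n → track a b (U p) ≡ shift b p + suc (p % k)
  track-U {a} {b} {p} a≤n a≤p p<a+n
    rewrite column-U p | splitAt-↑ʳ n n (p mod n) | unwrap-mod a≤n a≤p p<a+n = refl

  -- Walks avoiding a set of vertices

  module _ (X : Subset (n + n)) where

    Step : Rel (Fin (n + n)) 0ℓ
    Step = Deleting G (_∈ X)

    Step-sym : Symmetric Step
    Step-sym = Deleting-sym G (_∈ X)

    FreeBlock : ℕ → Set
    FreeBlock a = ∀ {p} → a ≤ p → p < a + k → V p ∉ X × U p ∉ X

    -- The equations with `t` select the vertices of one track, numbered as by `localTrack`, so that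
    -- outer and inner tracks are handled together.
    FreeTrack : ℕ → ℕ → ℕ → Set
    FreeTrack a b t = ∀ {p} → a ≤ p → p < b →
      (0 ≡ t → V p ∉ X) × (suc (p % k) ≡ t → U p ∉ X)

    -- Lets the first block serve again, one turn later, as the far end of the second part of the
    -- window.
    FreeBlock-+n : ∀ {a} → FreeBlock a → FreeBlock (a + n)
    FreeBlock-+n {a} free {p} a+n≤p p<a+n+k =
      subst (λ q → q ↑ˡ n ∉ X × n ↑ʳ q ∉ X)
        (trans (sym ([p+n]mod-n (p ∸ n))) (cong (_mod n) p≡))
        (free (+-cancelʳ-≤ n _ _ (subst (a + n ≤_) (sym p≡) a+n≤p))
              (+-cancelʳ-< n _ _ (subst₂ _<_ (sym p≡) a+n+k≡a+k+n p<a+n+k)))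
      where
      p≡ : p ∸ n + n ≡ p
      p≡ = m∸n+n≡m (≤-trans (m≤n+m n a) a+n≤p)

      a+n+k≡a+k+n : a + n + k ≡ a + k + n
      a+n+k≡a+k+n = trans (+-assoc a n k) (trans (cong (a +_) (+-comm n k)) (sym (+-assoc a k n)))

    outerWalk : ∀ m a → (∀ {p} → a ≤ p → p ≤ a + m → V p ∉ X) → Star Step (V a) (V (a + m))
    outerWalk zero    a free = subst (Star Step (V a) ∘ V) (sym (+-identityʳ a)) ε
    outerWalk (suc m) a free =
      (V~V a , free ≤-refl (m≤m+n a (suc m)) , free (m≤m+n a 1) (+-monoʳ-≤ a (s≤s z≤n)))
      ◅ subst (Star Step (V (a + 1)) ∘ V) (+-assoc a 1 m)
          (outerWalk m (a + 1) λ a+1≤p p≤ →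
            free (≤-trans (m≤m+n a 1) a+1≤p) (≤-trans p≤ (≤-reflexive (+-assoc a 1 m))))

    walkInBlock : ∀ {a} → FreeBlock a → ∀ {p} → a ≤ p → p < a + k → Star Step (V a) (V p)
    walkInBlock {a} free {p} a≤p p<a+k =
      subst (Star Step (V a) ∘ V) (m+[n∸m]≡n a≤p) (outerWalk (p ∸ a) a λ a≤q q≤ →
        proj₁ (free a≤q (≤-<-trans q≤ (subst (_< a + k) (sym (m+[n∸m]≡n a≤p)) p<a+k))))

    -- Steps of length `k` cannot jump over a block of `k` columns, so the walk lands in the block
    -- at `b`. The number `m` bounds the steps still to be made, each of which advances by at least
    -- 1.
    innerWalk : ∀ {a b r} → FreeTrack a b (suc r) → FreeBlock b →
                ∀ m p → b ≤ p + m → p % k ≡ r → a ≤ p → p < b + k →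
                ∃ λ q → b ≤ q × q < b + k × Star Step (U p) (U q)
    innerWalk {a} {b} {r} free blk m p b≤p+m p%k≡r a≤p p<b+k with p <? b
    ... | no  p≮b = p , ≮⇒≥ p≮b , p<b+k , ε
    innerWalk {a} {b} {r} free blk zero p b≤p+m p%k≡r a≤p p<b+k | yes p<b =
      contradiction (subst (b ≤_) (+-identityʳ p) b≤p+m) (<⇒≱ p<b)
    innerWalk {a} {b} {r} free blk (suc m) p b≤p+m p%k≡r a≤p p<b+k | yes p<b =
      let q , b≤q , q<b+k , walk =
            innerWalk free blk m (p + k) b≤p+k+m p+k%k≡r a≤p+k (+-monoˡ-< k p<b)
      in  q , b≤q , q<b+k ,
          (U~U p , proj₂ (free a≤p p<b) (cong suc p%k≡r) , p+k∉X) ◅ walk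
      where
      p+k%k≡r : (p + k) % k ≡ r
      p+k%k≡r = trans ([m+n]%n≡m%n p k) p%k≡r

      b≤p+k+m : b ≤ p + k + m
      b≤p+k+m = ≤-trans b≤p+m
        (≤-trans (+-monoʳ-≤ p (+-monoˡ-≤ m 1≤k)) (≤-reflexive (sym (+-assoc p k m))))

      a≤p+k : a ≤ p + k
      a≤p+k = ≤-trans a≤p (m≤m+n p k)

      p+k∉X : U (p + k) ∉ X
      p+k∉X with p + k <? b
      ... | yes p+k<b = proj₂ (free a≤p+k p+k<b) (cong suc p+k%k≡r)
      ... | no  p+k≮b = proj₂ (blk (≮⇒≥ p+k≮b) (+-monoˡ-< k p<b))

    -- Starting at a multiple of `k` puts column `i * k + r` on the inner track of residue `r`. The
    -- walk follows the outer path to that column, changes to the inner track along a spoke, and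
    -- returns to the outer path in the block at `b`. The end `b` is general because the way round
    -- the back ends at `i * k + n`.
    walkAlongTrack : ∀ i {b} t → t < suc k → i * k ≤ b → FreeBlock (i * k) → FreeBlock b →
                     FreeTrack (i * k) b t → Star Step (V (i * k)) (V b)
    walkAlongTrack i {b} zero t<1+k a≤b freeᵃ freeᵇ free =
      subst (Star Step (V (i * k)) ∘ V) (m+[n∸m]≡n a≤b)
        (outerWalk (b ∸ i * k) (i * k) λ {p} a≤p p≤ →
          V∉X a≤p (subst (p ≤_) (m+[n∸m]≡n a≤b) p≤))
      where
      V∉X : ∀ {p} → i * k ≤ p → p ≤ b → V p ∉ X
      V∉X {p} a≤p p≤b with p <? b
      ... | yes p<b = proj₁ (free a≤p p<b) refl
      ... | no  p≮b = proj₁ (freeᵇ (≮⇒≥ p≮b) (≤-<-trans p≤b (m<m+n b 1≤k)))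
    walkAlongTrack i {b} (suc r) (s≤s r<k) a≤b freeᵃ freeᵇ free
      with q , b≤q , q<b+k , walk ← innerWalk free freeᵇ b (i * k + r) (m≤n+m b (i * k + r))
             (trans (cong (_% k) (+-comm (i * k) r)) (trans ([m+kn]%n≡m%n r i k) (m<n⇒m%n≡m r<k)))
             (m≤m+n (i * k) r) (+-mono-≤-< a≤b r<k)
      = walkInBlock freeᵃ start≥ start<
        ◅◅ (V~U _ , proj₁ (freeᵃ start≥ start<) , proj₂ (freeᵃ start≥ start<))
        ◅ walk
        ◅◅ (~-sym (V~U q) , proj₂ (freeᵇ b≤q q<b+k) , proj₁ (freeᵇ b≤q q<b+k))
        ◅ Star.reverse Step-sym (walkInBlock freeᵇ b≤q q<b+k)
      where
      start≥ : i * k ≤ i * k + r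
      start≥ = m≤m+n (i * k) r

      start< : i * k + r < i * k + k
      start< = +-monoʳ-< (i * k) r<k

    -- Fewer than 2k + 2 deleted vertices miss one of the 2k + 2 tracks between the two blocks.
    freeBlocksJoined-≤ : ∣ X ∣ < suc k + suc k → ∀ {i j} → i ≤ j → j * k ≤ n →
                         FreeBlock (i * k) → FreeBlock (j * k) →
                         Star Step (V (i * k)) (V (j * k))
    freeBlocksJoined-≤ ∣X∣<2k+2 {i} {j} i≤j jk≤n freeᵃ freeᵇ
      with t , t<2k+2 , missed ← missedValue (track (i * k) (j * k)) X ∣X∣<2k+2
      with t <? suc k
    ... | yes t<1+k = walkAlongTrack i t t<1+k a≤b freeᵃ freeᵇ λ {p} a≤p p<b →
        (λ eq V∈X → missed V∈X (trans (track-V a≤n a≤p (p<a+n p<b))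
          (trans (cong (_+ 0) (shift-< p<b)) eq))) ,
        (λ eq U∈X → missed U∈X (trans (track-U a≤n a≤p (p<a+n p<b))
          (trans (cong (_+ suc (p % k)) (shift-< p<b)) eq)))
      where
      a≤b : i * k ≤ j * k
      a≤b = *-monoˡ-≤ k i≤j

      a≤n : i * k ≤ n
      a≤n = ≤-trans a≤b jk≤n

      p<a+n : ∀ {p} → p < j * k → p < i * k + n
      p<a+n p<b = <-≤-trans p<b (≤-trans jk≤n (m≤n+m n (i * k)))
    -- The missed track lies in the second part of the window: the walk runs from the block at
    -- `j * k` on to `i * k + n`, which is the first block again, and is then reversed.
    ... | no t≮1+k = Star.reverse Step-sym (subst (λ q → Star Step (V (j * k)) (q ↑ˡ n))
        ([p+n]mod-n (i * k))
        (walkAlongTrack j (t ∸ suc k) t∸<1+k (≤-trans jk≤n (m≤n+m n (i * k)))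
          freeᵇ (FreeBlock-+n freeᵃ)
          λ {p} b≤p p<a+n →
            (λ eq V∈X → missed V∈X (trans (track-V a≤n (≤-trans a≤b b≤p) p<a+n)
              (trans (cong (_+ 0) (shift-≥ b≤p)) (trans (cong (suc k +_) eq) t≡)))) ,
            (λ eq U∈X → missed U∈X (trans (track-U a≤n (≤-trans a≤b b≤p) p<a+n)
              (trans (cong (_+ suc (p % k)) (shift-≥ b≤p)) (trans (cong (suc k +_) eq) t≡))))))
      where
      a≤b : i * k ≤ j * k
      a≤b = *-monoˡ-≤ k i≤j

      a≤n : i * k ≤ n
      a≤n = ≤-trans a≤b jk≤n

      t≡ : suc k + (t ∸ suc k) ≡ t
      t≡ = m+[n∸m]≡n (≮⇒≥ t≮1+k)

      t∸<1+k : t ∸ suc k < suc k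
      t∸<1+k = +-cancelˡ-< (suc k) _ _ (subst (_< suc k + suc k) (sym t≡) t<2k+2)

    freeBlocksJoined : ∣ X ∣ < suc k + suc k → ∀ i j → i * k ≤ n → j * k ≤ n →
                       FreeBlock (i * k) → FreeBlock (j * k) →
                       Star Step (V (i * k)) (V (j * k))
    freeBlocksJoined ∣X∣<2k+2 i j ik≤n jk≤n freeᵃ freeᵇ with ≤-total i j
    ... | inj₁ i≤j = freeBlocksJoined-≤ ∣X∣<2k+2 i≤j jk≤n freeᵃ freeᵇ
    ... | inj₂ j≤i = Star.reverse Step-sym (freeBlocksJoined-≤ ∣X∣<2k+2 j≤i ik≤n freeᵇ freeᵃ)

    -- Division by `k` numbers the blocks. The vertices of `X` miss one of the numbers below `m`,
    -- and `m * k ≤ n` keeps the block of that number from wrapping around.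
    freeBlock : ∀ {m} → ∣ X ∣ < m → m * k ≤ n → ∃ λ i → i * k ≤ n × FreeBlock (i * k)
    freeBlock {m} ∣X∣<m mk≤n with i , i<m , missed ← missedValue (λ x → column x / k) X ∣X∣<m =
      i , ≤-trans (*-monoˡ-≤ k (<⇒≤ i<m)) mk≤n , λ {p} ik≤p p<ik+k →
        let p<[1+i]k = subst (p <_) (+-comm (i * k) k) p<ik+k
            p<n      = <-≤-trans p<[1+i]k (≤-trans (*-monoˡ-≤ k i<m) mk≤n)
            p/k≡i    = ≤-antisym (s≤s⁻¹ (m<n*o⇒m/o<n p<[1+i]k))
                         (subst (_≤ p / k) (m*n/n≡m i k) (/-monoˡ-≤ k ik≤p))
            column≡p : ∀ {c} → c ≡ toℕ (p mod n) → c ≡ p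
            column≡p eq = trans eq (toℕ-[p]mod-n p<n)
        in (λ V∈X → missed V∈X (trans (cong (_/ k) (column≡p (column-V p))) p/k≡i)) ,
           (λ U∈X → missed U∈X (trans (cong (_/ k) (column≡p (column-U p))) p/k≡i))

  -- 4k + 3 exceeds the number of vertices in two sets of at most 2k + 1 vertices.
  wideBag : (D : TreeDecomposition G) → (4 * k + 3) * k ≤ n →
            ¬ (∀ t → ∣ TreeDecomposition.bag D t ∣ ≤ 2 * k + 1)
  wideBag D mk≤n small = noHaven D (λ s → V (base s))
    (λ s → proj₁ (proj₂ (proj₂ (home s)) ≤-refl (m<m+n (base s) 1≤k)))
    touch
    where
    open TreeDecomposition D

    1+[2k+1]≡[1+k]+[1+k] : ∀ k → suc (2 * k + 1) ≡ suc k + suc k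
    1+[2k+1]≡[1+k]+[1+k] = solve-∀

    1+2[2k+1]≡4k+3 : ∀ k → suc (2 * k + 1 + (2 * k + 1)) ≡ 4 * k + 3
    1+2[2k+1]≡4k+3 = solve-∀

    small′ : ∀ s → ∣ bag s ∣ < suc k + suc k
    small′ s = ≤-<-trans (small s) (≤-reflexive (1+[2k+1]≡[1+k]+[1+k] k))

    home : ∀ s → ∃ λ i → i * k ≤ n × FreeBlock (bag s) (i * k)
    home s = freeBlock (bag s) (≤-<-trans
      (≤-trans (small s) (m≤m+n _ (2 * k + 1))) (≤-reflexive (1+2[2k+1]≡4k+3 k))) mk≤n

    base : Fin size → ℕ
    base s = proj₁ (home s) * k

    joinHome : ∀ s j → j * k ≤ n → FreeBlock (bag s) (j * k) →
               Star (Deleting G (_∈ bag s)) (V (base s)) (V (j * k))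
    joinHome s j jk≤n free = let i , ik≤n , freeⁱ = home s in
      freeBlocksJoined (bag s) (small′ s) i j ik≤n jk≤n freeⁱ free

    touch : ∀ s t → ∃ λ z → Star (Deleting G (_∈ bag s)) (V (base s)) z ×
                            Star (Deleting G (_∈ bag t)) (V (base t)) z
    touch s t with j , jk≤n , free ← freeBlock (bag s ∪ bag t) (≤-<-trans
        (≤-trans (∣p∪q∣≤∣p∣+∣q∣ (bag s) (bag t)) (+-mono-≤ (small s) (small t)))
        (≤-reflexive (1+2[2k+1]≡4k+3 k))) mk≤n
      = V (j * k) ,
        joinHome s j jk≤n (λ a≤p p<a+k → let (V∉ , U∉) = free a≤p p<a+k in V∉ ∘ p⊆p∪q _ , U∉ ∘ p⊆p∪q _) ,
        joinHome t j jk≤n (λ a≤p p<a+k → let (V∉ , U∉) = free a≤p p<a+k in V∉ ∘ q⊆p∪q _ _ , U∉ ∘ q⊆p∪q _ _)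

  -- Deleting v₀, u₀, …, uₖ₋₁, which are put into every bag, unrolls the graph into a strip. It is
  -- swept by two kinds of steps: vᵢ is exchanged for vᵢ₊₁ at time 2i, and uᵢ for uᵢ₊ₖ at time
  -- 2i + 1.
  vLeft vRight uLeft uRight : ℕ → ℕ
  -- Truncated subtraction gives column 0 the left end 0, as it must have to lie in every bag.
  vLeft c = 2 * (c ∸ 1)
  vRight zero    = 2 * n
  vRight (suc c) = 2 * suc c
  uLeft c with c <? k
  ... | yes _ = 0
  ... | no  _ = suc (2 * (c ∸ k))
  uRight c with c <? k
  ... | yes _ = 2 * n
  ... | no  _ = suc (2 * c)

  vLeft≤ : ∀ c → vLeft c ≤ 2 * c
  vLeft≤ c = *-monoʳ-≤ 2 (m∸n≤m c 1)

  vRight≥ : ∀ {c} → c ≤ n → 2 * c ≤ vRight c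
  vRight≥ {zero}  _ = z≤n
  vRight≥ {suc c} _ = ≤-refl

  uLeft≤ : ∀ c → uLeft c ≤ 2 * c
  uLeft≤ c with c <? k
  ... | yes _   = z≤n
  ... | no  c≮k = *-monoʳ-< 2 (∸-monoʳ-< {c} {k} {0} 1≤k (≮⇒≥ c≮k))

  uRight≥ : ∀ {c} → c < n → suc (2 * c) ≤ uRight c
  uRight≥ {c} c<n with c <? k
  ... | yes _ = *-monoʳ-< 2 c<n
  ... | no  _ = ≤-refl

  uLeft-< : ∀ {c} → c < k → uLeft c ≡ 0
  uLeft-< {c} c<k with c <? k
  ... | yes _   = refl
  ... | no  c≮k = contradiction c<k c≮k

  uRight-< : ∀ {c} → c < k → uRight c ≡ 2 * n
  uRight-< {c} c<k with c <? k
  ... | yes _   = refl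
  ... | no  c≮k = contradiction c<k c≮k

  uLeft-≥ : ∀ {c} → k ≤ c → uLeft c ≡ suc (2 * (c ∸ k))
  uLeft-≥ {c} k≤c with c <? k
  ... | yes c<k = contradiction k≤c (<⇒≱ c<k)
  ... | no  _   = refl

  left right : Fin n ⊎ Fin n → ℕ
  left  (v i) = vLeft (toℕ i)
  left  (u i) = uLeft (toℕ i)
  right (v i) = vRight (toℕ i)
  right (u i) = uRight (toℕ i)

  2i≤2n : ∀ (i : Fin n) → 2 * toℕ i ≤ 2 * n
  2i≤2n i = *-monoʳ-≤ 2 (<⇒≤ (toℕ<n i))

  2i≤uRight : ∀ (i : Fin n) → 2 * toℕ i ≤ uRight (toℕ i)
  2i≤uRight i = ≤-trans (n≤1+n _) (uRight≥ (toℕ<n i))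

  left≤right : ∀ x → left x ≤ right x
  left≤right (v i) = ≤-trans (vLeft≤ (toℕ i)) (vRight≥ (<⇒≤ (toℕ<n i)))
  left≤right (u i) = ≤-trans (uLeft≤ (toℕ i)) (2i≤uRight i)

  left≤2n : ∀ x → left x ≤ 2 * n
  left≤2n (v i) = ≤-trans (vLeft≤ (toℕ i)) (2i≤2n i)
  left≤2n (u i) = ≤-trans (uLeft≤ (toℕ i)) (2i≤2n i)

  -- Without wrap-around, the ends of an outer or inner arc share the time of their exchange,
  -- `2 * i` or `suc (2 * i)`, and the ends of a spoke share `2 * i`. An arc that wraps around ends
  -- at a vertex kept in every bag.
  arc-overlap : ∀ {x y} → Arc k x y → left x ≤ right y × left y ≤ right x
  arc-overlap (spoke {i} refl) =
    ≤-trans (vLeft≤ (toℕ i)) (2i≤uRight i) , ≤-trans (uLeft≤ (toℕ i)) (vRight≥ (<⇒≤ (toℕ<n i)))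
  arc-overlap (outer {i} refl) rewrite toℕ-⊕ i 1 | +-comm (toℕ i) 1 with suc (toℕ i) <? n
  ... | yes 1+i<n rewrite m<n⇒m%n≡m 1+i<n =
    ≤-trans (vLeft≤ (toℕ i)) (*-monoʳ-≤ 2 (n≤1+n (toℕ i))) , vRight≥ (<⇒≤ (toℕ<n i))
  ... | no 1+i≮n rewrite trans (%-congˡ {o = n} (≤-antisym (toℕ<n i) (≮⇒≥ 1+i≮n))) (n%n≡0 n) =
    left≤2n (v i) , z≤n
  arc-overlap (inner {i} refl) rewrite toℕ-⊕ i k with toℕ i + k <? n
  ... | yes i+k<n rewrite m<n⇒m%n≡m i+k<n =
    ≤-trans (uLeft≤ (toℕ i)) (≤-trans (*-monoʳ-≤ 2 (m≤m+n (toℕ i) k))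
      (≤-trans (n≤1+n _) (uRight≥ i+k<n))) ,
    ≤-trans (≤-reflexive (trans (uLeft-≥ (m≤n+m k (toℕ i)))
      (cong (λ c → suc (2 * c)) (m+n∸n≡m (toℕ i) k))))
      (uRight≥ (toℕ<n i))
  ... | no i+k≮n =
    ≤-trans (left≤2n (u i)) (≤-reflexive (sym (uRight-< wrapped<k))) ,
    ≤-trans (≤-reflexive (uLeft-< wrapped<k)) z≤n
    where
    wrapped<k : (toℕ i + k) % n < k
    wrapped<k = ≤-<-trans
      (≤-trans (≤-reflexive (sym (m≤n⇒[n∸m]%m≡n%m (≮⇒≥ i+k≮n)))) (m%n≤m _ n))
      (+-cancelʳ-< n _ _ (subst (_< k + n) (sym (m∸n+n≡m (≮⇒≥ i+k≮n)))
        (subst (toℕ i + k <_) (+-comm n k) (+-monoˡ-< k (toℕ<n i)))))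

  sweep : PathDecomposition G
  sweep = intervalDecomposition G (2 * n) (left ∘ splitAt n) (right ∘ splitAt n)
    (left≤right ∘ splitAt n) (left≤2n ∘ splitAt n)
    λ { (fwd a) → arc-overlap a ; (bwd a) → swap× (arc-overlap a) }

  -- Sizes of the bags of the sweep

  frame : List (Fin (n + n))
  frame = V 0 ∷ map U (upTo k)

  uRange : ℕ → ℕ → List (Fin (n + n))
  uRange i m = map (λ d → U (i + d)) (upTo m)

  -- These lists cover the bags at times `2 * i` and `suc (2 * i)`. To the `k + 1` vertices of the
  -- frame they add the front of `k + 1` vertices and the one being exchanged, so `2 * k + 3`
  -- entries in all.
  evenBag oddBag : ℕ → List (Fin (n + n))
  evenBag i = frame ++ V i ∷ V (suc i) ∷ uRange i k
  oddBag  i = frame ++ V (suc i) ∷ uRange i (suc k)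

  U∈uRange : ∀ {i m c} → i ≤ c → c < i + m → U c ∈ˡ uRange i m
  U∈uRange {i} {m} {c} i≤c c<i+m = subst (λ q → U q ∈ˡ uRange i m) (m+[n∸m]≡n i≤c)
    (∈-map⁺ (λ d → U (i + d)) (∈-upTo⁺
      (+-cancelˡ-< i _ _ (subst (_< i + m) (sym (m+[n∸m]≡n i≤c)) c<i+m))))

  2m≤1+2n⇒m≤n : ∀ {a b} → 2 * a ≤ suc (2 * b) → a ≤ b
  2m≤1+2n⇒m≤n {a} {b} le =
    s≤s⁻¹ (*-cancelˡ-< 2 a (suc b) (≤-trans (s≤s le) (≤-reflexive (sym (*-suc 2 b)))))

  V∈evenBag : ∀ {i} c → vLeft c ≤ 2 * i → 2 * i ≤ vRight c → V c ∈ˡ evenBag i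
  V∈evenBag zero    _ _ = here refl
  V∈evenBag {i} (suc c) l≤ ≤r with m≤n⇒m<n∨m≡n (*-cancelˡ-≤ {i} {suc c} 2 ≤r)
  ... | inj₂ refl  = ∈-++⁺ʳ frame (here refl)
  ... | inj₁ i<1+c with refl ← ≤-antisym (*-cancelˡ-≤ 2 l≤) (s≤s⁻¹ i<1+c) =
    ∈-++⁺ʳ frame (there (here refl))

  V∈oddBag : ∀ {i} c → vLeft c ≤ suc (2 * i) → suc (2 * i) ≤ vRight c → V c ∈ˡ oddBag i
  V∈oddBag zero    _ _ = here refl
  V∈oddBag {i} (suc c) l≤ ≤r
    with refl ← ≤-antisym (2m≤1+2n⇒m≤n l≤) (s≤s⁻¹ (*-cancelˡ-< 2 i (suc c) ≤r)) =
    ∈-++⁺ʳ frame (here refl)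

  U∈evenBag : ∀ {i} c → uLeft c ≤ 2 * i → 2 * i ≤ uRight c → U c ∈ˡ evenBag i
  U∈evenBag {i} c l≤ ≤r with c <? k
  ... | yes c<k = ∈-++⁺ˡ (there (∈-map⁺ U (∈-upTo⁺ c<k)))
  ... | no  c≮k = ∈-++⁺ʳ frame (there (there (U∈uRange (2m≤1+2n⇒m≤n ≤r)
    (subst (_< i + k) (m∸n+n≡m (≮⇒≥ c≮k)) (+-monoˡ-< k (*-cancelˡ-< 2 (c ∸ k) i l≤))))))

  U∈oddBag : ∀ {i} c → uLeft c ≤ suc (2 * i) → suc (2 * i) ≤ uRight c → U c ∈ˡ oddBag i
  U∈oddBag {i} c l≤ ≤r with c <? k
  ... | yes c<k = ∈-++⁺ˡ (there (∈-map⁺ U (∈-upTo⁺ c<k)))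
  ... | no  c≮k = ∈-++⁺ʳ frame (there (U∈uRange (*-cancelˡ-≤ 2 (s≤s⁻¹ ≤r))
    (subst₂ _<_ (m∸n+n≡m (≮⇒≥ c≮k)) (sym (+-suc i k))
      (s≤s (+-monoˡ-≤ k (*-cancelˡ-≤ 2 (s≤s⁻¹ l≤)))))))

  V-toℕ : ∀ (i : Fin n) → V (toℕ i) ≡ i ↑ˡ n
  V-toℕ i = cong (_↑ˡ n) (toℕ-injective (toℕ-[p]mod-n (toℕ<n i)))

  U-toℕ : ∀ (i : Fin n) → U (toℕ i) ≡ n ↑ʳ i
  U-toℕ i = cong (n ↑ʳ_) (toℕ-injective (toℕ-[p]mod-n (toℕ<n i)))

  vertexCases : ∀ {t} (xs : List (Fin (n + n))) →
                (∀ c → vLeft c ≤ t → t ≤ vRight c → V c ∈ˡ xs) →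
                (∀ c → uLeft c ≤ t → t ≤ uRight c → U c ∈ˡ xs) →
                ∀ x → left (splitAt n x) ≤ t → t ≤ right (splitAt n x) → x ∈ˡ xs
  vertexCases xs V∈ U∈ x l≤ ≤r with splitAt n x in eq
  ... | v i = subst (_∈ˡ xs) (trans (V-toℕ i) (splitAt⁻¹-↑ˡ eq)) (V∈ (toℕ i) l≤ ≤r)
  ... | u i = subst (_∈ˡ xs) (trans (U-toℕ i) (splitAt⁻¹-↑ʳ eq)) (U∈ (toℕ i) l≤ ≤r)

  length-uRange : ∀ i m → length (uRange i m) ≡ m
  length-uRange i m = trans (length-map _ (upTo m)) (length-upTo m)

  private
    bagLength : ∀ k → suc k + suc (suc k) ≡ 2 * k + 3
    bagLength = solve-∀

  length-evenBag : ∀ i → length (evenBag i) ≡ 2 * k + 3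
  length-evenBag i = trans (length-++ frame) (trans
    (cong₂ (λ a b → suc a + suc (suc b)) (length-uRange 0 k) (length-uRange i k)) (bagLength k))

  length-oddBag : ∀ i → length (oddBag i) ≡ 2 * k + 3
  length-oddBag i = trans (length-++ frame) (trans
    (cong₂ (λ a b → suc a + suc b) (length-uRange 0 k) (length-uRange i (suc k))) (bagLength k))

  evenOrOdd : ∀ t → ∃ λ i → t ≡ 2 * i ⊎ t ≡ suc (2 * i)
  evenOrOdd zero    = 0 , inj₁ refl
  evenOrOdd (suc t) with evenOrOdd t
  ... | i , inj₁ t≡2i   = i , inj₂ (cong suc t≡2i)
  ... | i , inj₂ t≡1+2i = suc i , inj₁ (trans (cong suc t≡1+2i) (sym (*-suc 2 i)))

  -- The time `t` is kept apart from `toℕ s` so that it can be given in the form `2 * i` or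
  -- `suc (2 * i)`.
  sweepBag≤length : ∀ s {t} → toℕ s ≡ t → (xs : List (Fin (n + n))) →
                    (∀ c → vLeft c ≤ t → t ≤ vRight c → V c ∈ˡ xs) →
                    (∀ c → uLeft c ≤ t → t ≤ uRight c → U c ∈ˡ xs) →
                    ∣ TreeDecomposition.bag (proj₁ sweep) s ∣ ≤ length xs
  sweepBag≤length s refl xs V∈ U∈ = ∣p∣≤length xs λ {x} x∈ →
    let l≤ , ≤r = ∈⟦⟧⁻ (λ x → left (splitAt n x) ≤? toℕ s ×-dec toℕ s ≤? right (splitAt n x)) x∈
    in  vertexCases xs V∈ U∈ x l≤ ≤r

  sweepBag-size : ∀ s → ∣ TreeDecomposition.bag (proj₁ sweep) s ∣ ≤ 2 * k + 3
  sweepBag-size s with evenOrOdd (toℕ s)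
  ... | i , inj₁ t≡2i = ≤-trans (sweepBag≤length s t≡2i (evenBag i) V∈evenBag U∈evenBag)
      (≤-reflexive (length-evenBag i))
  ... | i , inj₂ t≡1+2i = ≤-trans (sweepBag≤length s t≡1+2i (oddBag i) V∈oddBag U∈oddBag)
      (≤-reflexive (length-oddBag i))

theorem1p5 : ∀ (n k : ℕ) (1≤k : 1 ≤ k) (2k<n : 2 * k < n) →
    8 * (2 * k + 2) ^ 2 ≤ n →
    ∀ (tw pw : ℕ) →
    IsTreewidth (petersen n k 1≤k 2k<n) tw →
    IsPathwidth (petersen n k 1≤k 2k<n) pw →
    2 * k + 1 ≤ tw × tw ≤ pw × pw ≤ 2 * k + 2
theorem1p5 n k 1≤k 2k<n 8[2k+2]²≤n tw pw ((D , width≡tw) , tw-least) ((P , width≡pw) , pw-least) =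
  -- Since the width is one less than the largest bag size, a width below `2 * k + 1` leaves at most
  -- `2 * k + 1` vertices in each bag.
  ≮⇒≥ (λ tw<2k+1 → wideBag D (≤-trans enoughColumns 8[2k+2]²≤n)
    (bag≤ D (≤-trans (≤-reflexive width≡tw) (s≤s⁻¹ (subst (tw <_) (+-comm (2 * k) 1) tw<2k+1))))) ,
  tw-least (proj₁ P , width≡pw) ,
  ≤-trans (pw-least (sweep , refl)) (width≤ (proj₁ sweep) λ t →
    ≤-trans (sweepBag-size t) (≤-reflexive (sym (+-assoc (2 * k) 2 1))))
  where
  open Petersen n k 1≤k 2k<n

  -- The right-hand side is the unfolded form of the bound on `n`; the added polynomial is its
  -- excess over the columns needed for `4 * k + 3` blocks.
  expand : ∀ k → (4 * k + 3) * k + (28 * (k * k) + 61 * k + 32) ≡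
                 8 * ((2 * k + 2) * ((2 * k + 2) * 1))
  expand = solve-∀

  enoughColumns : (4 * k + 3) * k ≤ 8 * (2 * k + 2) ^ 2
  enoughColumns = ≤-trans (m≤m+n _ (28 * (k * k) + 61 * k + 32)) (≤-reflexive (expand k))
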